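{- Let $m, n, s, p, q$ be integers with $1 \leq s < n$ and $0 \leq p < q \leq (m-1)n$. Then there exists an $s$-ocycle for $\mathcal{B}_p^q(m,n)$.
   Context: An $m$-ary word (string) of length $n$ is a sequence $x = x_1x_2\ldots x_n$ with each $x_i \in \{0,1,\ldots,m-1\}$. Its weight is $wt(x) = \sum_{i=1}^n x_i$ (sum of integers). For $p<q$, $\mathcal{B}_p^q(m,n)$ denotes the set of all $m$-ary words $x$ of length $n$ with $p \leq wt(x) \leq q$. For a set $S$ of strings of length $n$ and an integer $s$ with $1 \le s \le n-1$, an $s$-overlap cycle ($s$-ocycle) for $S$ is a cyclic ordering of $S$, in which each element of $S$ appears exactly once, such that whenever $x = x_1\ldots x_n$ is followed by $y = y_1 \ldots y_n$ one has $x_{n-s+i} = y_i$ for all $i \in \{1,\ldots,s\}$ (the last $s$ letters of $x$ equal the first $s$ letters of $y$). The ordering being cyclic means that the last element of the ordering is followed by the first, and the overlap condition is also required there. -}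

module Defs where

open import Data.Fin.Base using (Fin; toℕ)
open import Data.List.Base using (List; []; _∷_; _∷ʳ_)
open import Data.List.Membership.Propositional using (_∈_)
open import Data.List.Relation.Unary.Linked using (Linked)
open import Data.List.Relation.Unary.Unique.Propositional using (Unique)
open import Data.Nat.Base using (ℕ; _+_; _∸_; _≤_; _<_)
open import Data.Product.Base using (_×_; ∃)
open import Data.Unit.Base using (⊤)
open import Data.Vec.Base as Vec using (Vec; lookup)
open import Function.Bundles using (_⇔_)
open import Level using (0ℓ)
open import Relation.Binary.Core using (Rel)
open import Relation.Binary.PropositionalEquality.Core using (_≡_)
open import Relation.Unary using (Pred)

Word : ℕ → ℕ → Set
Word m n = Vec (Fin m) n

wt : ∀ {m n} → Word m n → ℕ
wt x = Vec.sum (Vec.map toℕ x)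

-- The arguments are in the order of the notation 𝓑_p^q(m,n).
𝓑 : (p q m n : ℕ) → Pred (Word m n) 0ℓ
𝓑 p q m n x = p ≤ wt x × wt x ≤ q

-- The last s letters of x are the first s letters of y.  With positions
-- counted from 0, the letter of x at n ∸ s + j is the letter of y at j,
-- for every j < s.  The subtraction is exact only when s ≤ n.
Overlap : ∀ {m n} → ℕ → Rel (Word m n) 0ℓ
Overlap {n = n} s x y =
  (i j : Fin n) → toℕ j < s → toℕ i ≡ n ∸ s + toℕ j → lookup x i ≡ lookup y j

-- A cyclic ordering is given by a list, cut at an arbitrary element.  Its
-- first element is appended again so that the step from last to first is
-- included.
CyclicallyLinked : {A : Set} → Rel A 0ℓ → Pred (List A) 0ℓ
CyclicallyLinked R []       = ⊤
CyclicallyLinked R (x ∷ xs) = Linked R ((x ∷ xs) ∷ʳ x)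

record IsOCycle {m n : ℕ} (s : ℕ) (S : Pred (Word m n) 0ℓ)
                (xs : List (Word m n)) : Set where
  field
    unique   : Unique xs
    elements : ∀ x → x ∈ xs ⇔ S x
    overlaps : CyclicallyLinked (Overlap s) xs

HasOCycle : ∀ {m n} → ℕ → Pred (Word m n) 0ℓ → Set
HasOCycle s S = ∃ λ xs → IsOCycle s S xs

{-# OPTIONS --safe #-}
module Submission where

-- Rotating a word so that its last s letters come first preserves the weight,
-- and a word may be followed by its rotation; the orbits of this rotation thus
-- cover the set by cycles.  Two cycles merge if they contain words with the
-- same last s letters, since these words can exchange their successors.  Up to
-- rotation, any single letter can be moved in front of the last s letters and
-- changed there.  Finally, since p < q, any word can be brought closer to any
-- other one by raising or lowering a single letter by one without leaving the
-- weight range, so all the cycles merge into one.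

open import Defs
open import Data.Fin.Base using (Fin; zero; suc; toℕ; fromℕ<)
open import Data.Fin.Properties using (any?; toℕ<n; toℕ-injective; toℕ-fromℕ<)
  renaming (_≟_ to _≟ᶠ_)
open import Data.List.Base as List
  using (List; []; _∷_; _∷ʳ_; _++_; [_]; applyUpTo; filter; allFin; cartesianProductWith)
open import Data.List.Properties using (++-assoc; ++-identityʳ)
open import Data.List.Membership.Propositional using (_∈_; _∉_)
open import Data.List.Membership.Propositional.Properties
  using (∈-∃++; ∈-++⁺ˡ; ∈-++⁺ʳ; ∈-++⁻; ∈-applyUpTo⁺; ∈-applyUpTo⁻; ∈-filter⁺;
         ∈-allFin; ∈-cartesianProductWith⁺)
open import Data.List.Membership.DecPropositional using (_∈?_)
open import Data.List.Relation.Unary.All as All using (All; []; _∷_)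
open import Data.List.Relation.Unary.All.Properties using (all-filter)
open import Data.List.Relation.Unary.AllPairs as AllPairs using ()
open import Data.List.Relation.Unary.Any using (here)
open import Data.List.Relation.Unary.Linked using (Linked; []; [-]; _∷_)
open import Data.List.Relation.Unary.Unique.Propositional using (Unique)
open import Data.List.Relation.Unary.Unique.Propositional.Properties as Unique
  using (applyUpTo⁺₁)
open import Data.List.Relation.Binary.Permutation.Propositional
  using (_↭_; ↭-sym; ↭⇒↭ₛ)
open import Data.List.Relation.Binary.Permutation.Propositional.Properties
  using (shifts; ∈-resp-↭)
open import Data.List.Relation.Binary.Permutation.Setoid.Properties using (Unique-resp-↭)
open import Data.Nat.Base
open import Data.Nat.GeneralisedArithmetic using (fold; fold-+)
open import Data.Nat.Properties
open import Data.Nat.Induction using (<-wellFounded; Acc; acc)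
open import Data.Product.Base using (_×_; _,_; proj₁; proj₂; ∃; ∃₂)
open import Data.Sum.Base using (_⊎_; inj₁; inj₂)
open import Data.Unit.Base using (tt)
open import Data.Vec.Base as Vec using (Vec; []; _∷_; lookup; _[_]≔_; toList)
open import Data.Vec.Properties
  using (≡-dec; toList-∷ʳ; toList-injective; cast-is-id; length-toList; lookup∘update′)
open import Function.Base using (_∘_; id; case_of_)
open import Function.Bundles using (mk⇔)
open import Level using (0ℓ)
open import Relation.Binary.Construct.Closure.ReflexiveTransitive using (Star; ε; _◅_; _◅◅_)
open import Relation.Binary.Core using (Rel)
open import Relation.Binary.Definitions using (DecidableEquality)
open import Relation.Binary.PropositionalEquality
  using (_≡_; _≢_; refl; sym; trans; cong; cong₂; subst; subst₂; setoid; module ≡-Reasoning)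
open import Relation.Nullary using (¬_; yes; no; contradiction)
open import Relation.Nullary.Decidable using (_×-dec_)
open import Relation.Unary using (Pred; Decidable)

-- Least witnesses, iteration and cyclically linked lists.

least : {P : Pred ℕ 0ℓ} → Decidable P → ∀ n → P n →
        ∃ λ k → P k × (∀ {i} → i < k → ¬ P i)
least P? n       pn with P? 0
least P? n       pn | yes p₀ = 0 , p₀ , λ ()
least P? zero    pn | no ¬p₀ = contradiction pn ¬p₀
least P? (suc n) pn | no ¬p₀ =
  let k , pk , below = least (P? ∘ suc) n pn in
  suc k , pk , λ { {zero} _ → ¬p₀ ; {suc i} (s≤s i<k) → below i<k }

fold-shift : ∀ {A : Set} (x : A) f i → fold (f x) f i ≡ fold x f (suc i)
fold-shift x f zero    = refl
fold-shift x f (suc i) = cong f (fold-shift x f i)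

module _ {A : Set} (R : Rel A 0ℓ) where

  linked-applyUpTo-++ : ∀ f k {c cs} → (∀ i → R (f i) (f (suc i))) → R (f k) c →
    Linked R (c ∷ cs) → Linked R (applyUpTo f (suc k) ++ c ∷ cs)
  linked-applyUpTo-++ f zero    step last cs = last ∷ cs
  linked-applyUpTo-++ f (suc k) step last cs =
    step 0 ∷ linked-applyUpTo-++ (f ∘ suc) k (step ∘ suc) last cs

  module _ {x : A} {ys : List A}
           (graft : ∀ {c cs} → Linked R (x ∷ c ∷ cs) → Linked R (x ∷ ys ++ c ∷ cs)) where

    linked-insert : ∀ as bs {h} → Linked R (as ++ x ∷ (bs ∷ʳ h)) →
                    Linked R (as ++ x ∷ (ys ++ (bs ∷ʳ h)))
    -- `bs ∷ʳ h` reduces to a cons only once `bs` is split, and `graft` has to see the successor of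
    -- `x`.
    linked-insert []           []      l       = graft l
    linked-insert []           (_ ∷ _) l       = graft l
    linked-insert (a ∷ [])     bs      (r ∷ l) = r ∷ linked-insert [] bs l
    linked-insert (a ∷ b ∷ as) bs      (r ∷ l) = r ∷ linked-insert (b ∷ as) bs l

    -- Insertion takes place after `x`, so the head of the list, which closes the cycle, stays the
    -- same: it is `x` if `as` is empty and the head of `as` otherwise.
    cyclicallyLinked-insert : ∀ as bs → CyclicallyLinked R (as ++ x ∷ bs) →
                              CyclicallyLinked R (as ++ x ∷ (ys ++ bs))
    cyclicallyLinked-insert [] bs l
      rewrite ++-assoc ys bs [ x ] = linked-insert [] bs l
    cyclicallyLinked-insert (a ∷ as) bs l
      rewrite ++-assoc as (x ∷ bs) [ a ]
            | ++-assoc as (x ∷ (ys ++ bs)) [ a ]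
            | ++-assoc ys bs [ a ] = linked-insert (a ∷ as) bs l

-- Joining the orbits of a permutation into a single cycle.

module CycleJoining
  {A : Set} (_≟_ : DecidableEquality A) (S : Pred A 0ℓ) (R _≈_ : Rel A 0ℓ)
  (≈-sym : ∀ {x y} → x ≈ y → y ≈ x)
  (R-resp-≈ : ∀ {x y z} → x ≈ y → R x z → R y z)
  (σ : A → A) (N : ℕ) (σ-period : ∀ x → fold x σ (suc N) ≡ x)
  (σ-R : ∀ x → R x (σ x)) (σ-S : ∀ {x} → S x → S (σ x))
  where

  -- The moves along which a cycle can be followed or extended. The first two stay within an orbit
  -- of `σ`; only `switch` can lead to a new orbit, so only it asks that its target be in `S`.
  data Step (x : A) : A → Set where
    forward  : Step x (σ x)
    backward : ∀ {y} → σ y ≡ x → Step x y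
    switch   : ∀ {y} → S y → x ≈ y → Step x y

  -- By the period, `N` further applications of `σ` undo one application.
  σ-injective : ∀ {x y} → σ x ≡ σ y → x ≡ y
  σ-injective {x} {y} eq = begin
    x                ≡⟨ σ-period x ⟨
    fold x σ (suc N) ≡⟨ fold-shift x σ N ⟨
    fold (σ x) σ N   ≡⟨ cong (λ z → fold z σ N) eq ⟩
    fold (σ y) σ N   ≡⟨ fold-shift y σ N ⟩
    fold y σ (suc N) ≡⟨ σ-period y ⟩
    y                ∎
    where open ≡-Reasoning

  fold-injective : ∀ i {x y} → fold x σ i ≡ fold y σ i → x ≡ y
  fold-injective zero    eq = eq
  fold-injective (suc i) eq = fold-injective i (σ-injective eq)

  fold-closed : ∀ (P : Pred A 0ℓ) → (∀ {x} → P x → P (σ x)) → ∀ {x} i → P x → P (fold x σ i)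
  fold-closed P closed zero    px = px
  fold-closed P closed (suc i) px = closed (fold-closed P closed i px)

  -- As `σ` has finite order, its inverse is a power of `σ`, so closure under `σ` gives closure
  -- under the inverse.
  fold-closed⁻ : ∀ (P : Pred A 0ℓ) → (∀ {x} → P x → P (σ x)) → ∀ {x} i → P (fold x σ i) → P x
  fold-closed⁻ P closed zero        p = p
  fold-closed⁻ P closed {x} (suc i) p = fold-closed⁻ P closed i
    (subst P (trans (fold-shift y σ N) (σ-period y)) (fold-closed P closed N p))
    where y = fold x σ i

  -- The size is stored less one, which makes `elems` nonempty and `size-1` the index of its last
  -- element.
  record Orbit (z : A) : Set where
    field
      size-1    : ℕ
      return    : fold z σ (suc size-1) ≡ z
      no-return : ∀ {i} → i < size-1 → fold z σ (suc i) ≢ z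

    elems : List A
    elems = applyUpTo (fold z σ) (suc size-1)

    distinct : Unique elems
    distinct = applyUpTo⁺₁ (fold z σ) (suc size-1) apart
      where
      open ≡-Reasoning
      -- Cancelling the first `i` applications turns a repetition into a return to `z` after `suc o`
      -- steps, which is too early.
      apart : ∀ {i j} → i < j → j < suc size-1 → fold z σ i ≢ fold z σ j
      apart {i} i<j j<k eq with o , refl ← m≤n⇒∃[o]m+o≡n i<j =
        no-return (≤-<-trans (m≤n+m o i) (s<s⁻¹ j<k)) (sym (fold-injective i (begin
          fold z σ i                  ≡⟨ eq ⟩
          fold z σ (suc (i + o))      ≡⟨ cong (fold z σ) (+-suc i o) ⟨
          fold z σ (i + suc o)        ≡⟨ fold-+ z σ i ⟩
          fold (fold z σ (suc o)) σ i ∎)))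

    closed : ∀ {x} → x ∈ elems → σ x ∈ elems
    closed x∈ with i , i<k , refl ← ∈-applyUpTo⁻ (fold z σ) x∈ with suc i <? suc size-1
    ... | yes si<k = ∈-applyUpTo⁺ (fold z σ) si<k
    ... | no  si≮k = here (trans (cong (fold z σ) (≤-antisym i<k (≮⇒≥ si≮k))) return)

    linked-++ : ∀ {c cs} → R (fold z σ size-1) c → Linked R (c ∷ cs) →
                Linked R (elems ++ c ∷ cs)
    linked-++ = linked-applyUpTo-++ R (fold z σ) size-1 (λ i → σ-R (fold z σ i))

  orbit : ∀ z → Orbit z
  orbit z = let k , ret , below = least (λ i → fold z σ (suc i) ≟ z) N (σ-period z) in
    record { size-1 = k ; return = ret ; no-return = below }

  -- By `closed` the list is a union of whole orbits, so an orbit with one element outside the list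
  -- is disjoint from it.
  record Cycle (xs : List A) : Set where
    field
      unique : Unique xs
      linked : CyclicallyLinked R xs
      inside : ∀ {x} → x ∈ xs → S x
      closed : ∀ {x} → x ∈ xs → σ x ∈ xs

  orbit-inside : ∀ {z} → S z → ∀ {x} → x ∈ Orbit.elems (orbit z) → S x
  orbit-inside {z} sz x∈ with i , _ , refl ← ∈-applyUpTo⁻ (fold z σ) x∈ = fold-closed S σ-S i sz

  orbit-cycle : ∀ {z} → S z → Cycle (Orbit.elems (orbit z))
  orbit-cycle {z} sz = record
    { unique = distinct
    ; linked = linked-++ (subst (R (fold z σ size-1)) return (σ-R _)) [-]
    ; inside = orbit-inside sz
    ; closed = closed
    }
    where open Orbit (orbit z)

  -- Since x ≈ y, x and y may exchange their successors.
  join : ∀ {xs x y} → Cycle xs → x ∈ xs → y ∉ xs → S y → x ≈ y →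
         ∃ λ ys → Cycle ys × (∀ {z} → z ∈ xs → z ∈ ys) × y ∈ ys
  join {y = y} C x∈ y∉ sy x≈y with as , bs , refl ← ∈-∃++ x∈ =
    as ++ _ ∷ (elems ++ bs) , C′ , grow ∘ ∈-++⁺ʳ elems , grow (∈-++⁺ˡ y∈O)
    where
    x = _
    module C = Cycle C
    -- Starting the orbit at `σ y` puts `y` last: inserted after `x`, the orbit is entered by the
    -- step from `x` to `σ y` and left by the step from `y` to the old successor of `x`.
    open Orbit (orbit (σ y))

    last≡y : fold (σ y) σ size-1 ≡ y
    last≡y = σ-injective return

    y∈O : y ∈ elems
    y∈O = subst (_∈ elems) last≡y (∈-applyUpTo⁺ (fold (σ y) σ) ≤-refl)

    perm : elems ++ (as ++ x ∷ bs) ↭ as ++ x ∷ (elems ++ bs)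
    perm = subst₂ (λ l r → elems ++ l ↭ r)
      (++-assoc as [ x ] bs) (++-assoc as [ x ] (elems ++ bs)) (shifts elems (as ∷ʳ x))

    grow : ∀ {z} → z ∈ elems ++ (as ++ x ∷ bs) → z ∈ as ++ x ∷ (elems ++ bs)
    grow = ∈-resp-↭ perm

    disjoint : ∀ {z} → ¬ (z ∈ elems × z ∈ as ++ x ∷ bs)
    -- A common element is an iterate of `σ y`, so undoing the iterations would put `y` into the old
    -- cycle.
    disjoint (z∈O , z∈xs) with i , _ , refl ← ∈-applyUpTo⁻ (fold (σ y) σ) z∈O =
      y∉ (fold-closed⁻ (_∈ _) C.closed (suc i) (subst (_∈ _) (fold-shift y σ i) z∈xs))

    C′ : Cycle (as ++ x ∷ (elems ++ bs))
    C′ = record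
      { unique = Unique-resp-↭ (setoid A) (↭⇒↭ₛ perm)
                   (Unique.++⁺ distinct C.unique disjoint)
      ; linked = cyclicallyLinked-insert R
          (λ { (r ∷ l) → R-resp-≈ (≈-sym x≈y) (σ-R y)
                         ∷ linked-++ (subst (λ w → R w _) (sym last≡y) (R-resp-≈ x≈y r)) l })
          as bs C.linked
      ; inside = λ z∈ → case ∈-++⁻ elems (∈-resp-↭ (↭-sym perm) z∈) of λ where
          (inj₁ z∈O)  → orbit-inside (σ-S sy) z∈O
          (inj₂ z∈xs) → C.inside z∈xs
      ; closed = λ z∈ → case ∈-++⁻ elems (∈-resp-↭ (↭-sym perm) z∈) of λ where
          (inj₁ z∈O)  → grow (∈-++⁺ˡ (closed z∈O))
          (inj₂ z∈xs) → grow (∈-++⁺ʳ elems (C.closed z∈xs))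
      }

  -- Moves along `σ` in either direction stay inside the list; a `switch` to an element not yet
  -- listed inserts the whole orbit of that element.
  reach : ∀ {xs x y} → Cycle xs → x ∈ xs → Star Step x y →
          ∃ λ ys → Cycle ys × (∀ {z} → z ∈ xs → z ∈ ys) × y ∈ ys
  reach C x∈ ε = _ , C , id , x∈
  reach C x∈ (forward ◅ p) = reach C (Cycle.closed C x∈) p
  reach C x∈ (backward refl ◅ p) = reach C (fold-closed⁻ (_∈ _) (Cycle.closed C) 1 x∈) p
  reach {xs} C x∈ (switch {y} sy x≈y ◅ p) with _∈?_ _≟_ y xs
  ... | yes y∈ = reach C y∈ p
  ... | no  y∉ =
    let _ , C′ , sub , y∈ = join C x∈ y∉ sy x≈y
        _ , C″ , sub′ , z∈ = reach C′ y∈ p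
    in _ , C″ , sub′ ∘ sub , z∈

  -- Since `reach` only enlarges the cycle, the elements absorbed earlier remain in it.
  absorb : (∀ {x y} → S x → S y → Star Step x y) → ∀ {xs x} → Cycle xs → x ∈ xs →
           ∀ {ys} → All S ys →
           ∃ λ zs → Cycle zs × (∀ {z} → z ∈ xs → z ∈ zs) × All (_∈ zs) ys
  absorb conn C x∈ [] = _ , C , id , []
  absorb conn C x∈ (sy ∷ sys) =
    let _ , C′ , sub , y∈ = reach C x∈ (conn (Cycle.inside C x∈) sy)
        _ , C″ , sub′ , rest = absorb conn C′ y∈ sys
    in _ , C″ , sub′ ∘ sub , sub′ y∈ ∷ rest

  hamiltonian : (∀ {x y} → S x → S y → Star Step x y) →
                ∀ {ys} → All S ys → (∀ {x} → S x → x ∈ ys) →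
                ∃ λ zs → Cycle zs × (∀ {x} → S x → x ∈ zs)
  -- With `S` empty there is no orbit to start from, and the empty list serves as the cycle.
  hamiltonian conn [] complete =
    [] , record { unique = AllPairs.[] ; linked = tt ; inside = λ () ; closed = λ () } , complete
  hamiltonian conn (sy ∷ sys) complete =
    let _ , C , _ , all = absorb conn (orbit-cycle sy) (here refl) (sy ∷ sys)
    in _ , C , All.lookup all ∘ complete

-- Iterated rotation of words.

fold-∘ : ∀ {A : Set} (x : A) f m n → fold x (λ y → fold y f n) m ≡ fold x f (m * n)
fold-∘ x f zero    n = refl
fold-∘ x f (suc m) n = trans (cong (λ y → fold y f n) (fold-∘ x f m n)) (sym (fold-+ x f n))

fold-fixed : ∀ {A : Set} {x : A} f → f x ≡ x → ∀ n → fold x f n ≡ x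
fold-fixed f eq zero    = refl
fold-fixed f eq (suc n) = trans (cong f (fold-fixed f eq n)) eq

module _ {A : Set} where

  rotateˡ : List A → List A
  rotateˡ []       = []
  rotateˡ (x ∷ xs) = xs ∷ʳ x

  -- On lists the length is not part of the type, so blocks can be exchanged without casts. Taking
  -- `[]` for `ys` yields the period of rotation.
  rotateˡ-++ : ∀ xs ys → fold (xs ++ ys) rotateˡ (List.length xs) ≡ ys ++ xs
  rotateˡ-++ []       ys = sym (++-identityʳ ys)
  rotateˡ-++ (x ∷ xs) ys = begin
    fold (x ∷ xs ++ ys) rotateˡ (suc (List.length xs))
      ≡⟨ fold-shift (x ∷ xs ++ ys) rotateˡ (List.length xs) ⟨
    fold ((xs ++ ys) ++ [ x ]) rotateˡ (List.length xs)
      ≡⟨ cong (λ l → fold l rotateˡ (List.length xs)) (++-assoc xs ys [ x ]) ⟩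
    fold (xs ++ ys ++ [ x ]) rotateˡ (List.length xs)
      ≡⟨ rotateˡ-++ xs (ys ∷ʳ x) ⟩
    (ys ++ [ x ]) ++ xs
      ≡⟨ ++-assoc ys [ x ] xs ⟩
    ys ++ x ∷ xs
      ∎
    where open ≡-Reasoning

  rotate : ∀ {n} → Vec A n → Vec A n
  rotate []       = []
  rotate (x ∷ xs) = xs Vec.∷ʳ x

  toList-rotates : ∀ {n} (xs : Vec A n) k → toList (fold xs rotate k) ≡ fold (toList xs) rotateˡ k
  toList-rotates xs zero    = refl
  toList-rotates xs (suc k) =
    trans (toList-rotate (fold xs rotate k)) (cong rotateˡ (toList-rotates xs k))
    where
    toList-rotate : ∀ {n} (xs : Vec A n) → toList (rotate xs) ≡ rotateˡ (toList xs)
    toList-rotate []       = refl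
    toList-rotate (x ∷ xs) = toList-∷ʳ x xs

  rotate-period : ∀ {n} (xs : Vec A n) → fold xs rotate n ≡ xs
  rotate-period {n} xs = trans (sym (cast-is-id refl (fold xs rotate n))) (toList-injective refl _ _ (begin
    toList (fold xs rotate n)
      ≡⟨ toList-rotates xs n ⟩
    fold (toList xs) rotateˡ n
      ≡⟨ cong₂ (λ l k → fold l rotateˡ k) (++-identityʳ (toList xs)) (length-toList xs) ⟨
    fold (toList xs ++ []) rotateˡ (List.length (toList xs))
      ≡⟨ rotateˡ-++ (toList xs) [] ⟩
    toList xs
      ∎))
    where open ≡-Reasoning

  -- Rotating `n` times by `t` amounts to rotating `t` times by `n`, and each rotation by `n` is the
  -- identity.
  rotates-period : ∀ {n} (xs : Vec A n) t → fold xs (λ ys → fold ys rotate t) n ≡ xs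
  rotates-period {n} xs t = begin
    fold xs (λ ys → fold ys rotate t) n ≡⟨ fold-∘ xs rotate n t ⟩
    fold xs rotate (n * t)              ≡⟨ cong (fold xs rotate) (*-comm n t) ⟩
    fold xs rotate (t * n)              ≡⟨ fold-∘ xs rotate t n ⟨
    fold xs (λ ys → fold ys rotate n) t ≡⟨ fold-fixed (λ ys → fold ys rotate n) (rotate-period xs) t ⟩
    xs                                  ∎
    where open ≡-Reasoning

  lookup-∷ʳ : ∀ {n} (xs : Vec A n) x i j → toℕ i ≡ toℕ j → lookup (xs Vec.∷ʳ x) j ≡ lookup xs i
  lookup-∷ʳ (y ∷ xs) x zero    zero    eq = refl
  lookup-∷ʳ (y ∷ xs) x (suc i) (suc j) eq = lookup-∷ʳ xs x i j (suc-injective eq)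

  ≔-∷ʳ : ∀ {n} (xs : Vec A n) x i j {a} → toℕ i ≡ toℕ j →
         (xs [ i ]≔ a) Vec.∷ʳ x ≡ (xs Vec.∷ʳ x) [ j ]≔ a
  ≔-∷ʳ (y ∷ xs) x zero    zero    eq = refl
  ≔-∷ʳ (y ∷ xs) x (suc i) (suc j) eq = cong (y ∷_) (≔-∷ʳ xs x i j (suc-injective eq))

  -- Used in the inductions on the number of rotations: `k` is where the letter from position `i`
  -- stands after `t` of the `suc t` rotations.
  successor-position : ∀ {n} (i j : Fin n) t → toℕ i ≡ suc t + toℕ j →
                       ∃ λ (k : Fin n) → toℕ k ≡ suc (toℕ j) × toℕ i ≡ t + toℕ k
  successor-position {n} i j t eq = fromℕ< sj<n , toℕ-fromℕ< sj<n ,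
    trans eq (trans (sym (+-suc t (toℕ j))) (cong (t +_) (sym (toℕ-fromℕ< sj<n))))
    where
    sj<n : suc (toℕ j) < n
    sj<n = ≤-<-trans (subst (suc (toℕ j) ≤_) (sym eq) (s≤s (m≤n+m (toℕ j) t))) (toℕ<n i)

  -- With `n ∸ s` for `t`, this is the overlap of a word with its rotation. The equation on
  -- positions selects the letters that are not carried around the end.
  lookup-rotates : ∀ {n} (xs : Vec A n) t i j → toℕ i ≡ t + toℕ j →
                   lookup xs i ≡ lookup (fold xs rotate t) j
  lookup-rotates xs zero    i j eq = cong (lookup xs) (toℕ-injective eq)
  lookup-rotates xs (suc t) i j eq =
    let k , k≡ , i≡ = successor-position i j t eq
    in trans (lookup-rotates xs t i k i≡) (lookup-rotate (fold xs rotate t) k j k≡)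
    where
    lookup-rotate : ∀ {n} (xs : Vec A n) i j → toℕ i ≡ suc (toℕ j) → lookup xs i ≡ lookup (rotate xs) j
    lookup-rotate (x ∷ xs) (suc i) j eq = sym (lookup-∷ʳ xs x i j (suc-injective eq))

  rotates-≔ : ∀ {n} (xs : Vec A n) t i j {a} → toℕ i ≡ t + toℕ j →
              fold (xs [ i ]≔ a) rotate t ≡ fold xs rotate t [ j ]≔ a
  rotates-≔ xs zero    i j eq = cong (xs [_]≔ _) (toℕ-injective eq)
  rotates-≔ xs (suc t) i j eq =
    let k , k≡ , i≡ = successor-position i j t eq
    in trans (cong rotate (rotates-≔ xs t i k i≡)) (rotate-≔ (fold xs rotate t) k j k≡)
    where
    rotate-≔ : ∀ {n} (xs : Vec A n) i j {a} → toℕ i ≡ suc (toℕ j) →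
               rotate (xs [ i ]≔ a) ≡ rotate xs [ j ]≔ a
    rotate-≔ (x ∷ xs) (suc i) j eq = ≔-∷ʳ xs x i j (suc-injective eq)

-- Weights under rotation, replacement and the pointwise order.

wt-rotates : ∀ {m n} (x : Word m n) t → wt (fold x rotate t) ≡ wt x
wt-rotates x zero    = refl
wt-rotates x (suc t) = trans (wt-rotate (fold x rotate t)) (wt-rotates x t)
  where
  wt-∷ʳ : ∀ {m n} a (x : Word m n) → wt (x Vec.∷ʳ a) ≡ toℕ a + wt x
  wt-∷ʳ a []      = refl
  wt-∷ʳ a (b ∷ x) = begin
    toℕ b + wt (x Vec.∷ʳ a)  ≡⟨ cong (toℕ b +_) (wt-∷ʳ a x) ⟩
    toℕ b + (toℕ a + wt x)   ≡⟨ +-assoc (toℕ b) (toℕ a) (wt x) ⟨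
    toℕ b + toℕ a + wt x     ≡⟨ cong (_+ wt x) (+-comm (toℕ b) (toℕ a)) ⟩
    toℕ a + toℕ b + wt x     ≡⟨ +-assoc (toℕ a) (toℕ b) (wt x) ⟩
    toℕ a + (toℕ b + wt x)   ∎
    where open ≡-Reasoning

  wt-rotate : ∀ {m n} (x : Word m n) → wt (rotate x) ≡ wt x
  wt-rotate []      = refl
  wt-rotate (a ∷ x) = wt-∷ʳ a x

-- Both sides count the old and the new letter on top of the unchanged rest; this form avoids
-- truncated subtraction.
wt-≔ : ∀ {m n} (x : Word m n) i a → wt (x [ i ]≔ a) + toℕ (lookup x i) ≡ wt x + toℕ a
wt-≔ (b ∷ x) zero    a = begin
  toℕ a + wt x + toℕ b   ≡⟨ +-assoc (toℕ a) (wt x) (toℕ b) ⟩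
  toℕ a + (wt x + toℕ b) ≡⟨ +-comm (toℕ a) (wt x + toℕ b) ⟩
  wt x + toℕ b + toℕ a   ≡⟨ cong (_+ toℕ a) (+-comm (wt x) (toℕ b)) ⟩
  toℕ b + wt x + toℕ a   ∎
  where open ≡-Reasoning
wt-≔ (b ∷ x) (suc i) a = begin
  toℕ b + wt (x [ i ]≔ a) + toℕ (lookup x i)   ≡⟨ +-assoc (toℕ b) (wt (x [ i ]≔ a)) _ ⟩
  toℕ b + (wt (x [ i ]≔ a) + toℕ (lookup x i)) ≡⟨ cong (toℕ b +_) (wt-≔ x i a) ⟩
  toℕ b + (wt x + toℕ a)                       ≡⟨ +-assoc (toℕ b) (wt x) (toℕ a) ⟨
  toℕ b + wt x + toℕ a                         ∎
  where open ≡-Reasoning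

_≤ʷ_ : ∀ {m n} → Rel (Word m n) 0ℓ
x ≤ʷ y = ∀ i → toℕ (lookup x i) ≤ toℕ (lookup y i)

wt-mono : ∀ {m n} (x y : Word m n) → x ≤ʷ y → wt x ≤ wt y
wt-mono []      []      x≤y = z≤n
wt-mono (a ∷ x) (b ∷ y) x≤y = +-mono-≤ (x≤y zero) (wt-mono x y (x≤y ∘ suc))

-- The reverse inequality of weights leaves no slack at any position.
≤ʷ-wt-≡ : ∀ {m n} (x y : Word m n) → x ≤ʷ y → wt y ≤ wt x → x ≡ y
≤ʷ-wt-≡ []      []      x≤y wy≤wx = refl
≤ʷ-wt-≡ (a ∷ x) (b ∷ y) x≤y wy≤wx = cong₂ _∷_
  (toℕ-injective (≤-antisym (x≤y zero)
    (+-cancelʳ-≤ (wt y) (toℕ b) (toℕ a)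
      (≤-trans wy≤wx (+-monoʳ-≤ (toℕ a) (wt-mono x y (x≤y ∘ suc)))))))
  (≤ʷ-wt-≡ x y (x≤y ∘ suc)
    (+-cancelˡ-≤ (toℕ b) (wt y) (wt x) (≤-trans wy≤wx (+-monoˡ-≤ (wt x) (x≤y zero)))))

-- The Manhattan distance and single-letter moves towards a target word.

dist : ∀ {m n} → Word m n → Word m n → ℕ
dist x y = Vec.sum (Vec.zipWith (λ a b → ∣ toℕ a - toℕ b ∣) x y)

dist-≔ : ∀ {m n} (x y : Word m n) i a →
         ∣ toℕ a - toℕ (lookup y i) ∣ < ∣ toℕ (lookup x i) - toℕ (lookup y i) ∣ →
         dist (x [ i ]≔ a) y < dist x y
dist-≔ (b ∷ x) (c ∷ y) zero    a lt = +-monoˡ-< (dist x y) lt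
dist-≔ (b ∷ x) (c ∷ y) (suc i) a lt = +-monoʳ-< ∣ toℕ b - toℕ c ∣ (dist-≔ x y i a lt)

∣1+m-n∣<∣m-n∣ : ∀ {m n} → m < n → ∣ suc m - n ∣ < ∣ m - n ∣
∣1+m-n∣<∣m-n∣ {zero}  (s≤s z≤n) = ≤-refl
∣1+m-n∣<∣m-n∣ {suc m} (s≤s m<n) = ∣1+m-n∣<∣m-n∣ m<n

∣m-n∣<∣1+m-n∣ : ∀ {m n} → n ≤ m → ∣ m - n ∣ < ∣ suc m - n ∣
∣m-n∣<∣1+m-n∣ {m} z≤n       = s≤s (≤-reflexive (∣-∣-identityʳ m))
∣m-n∣<∣1+m-n∣     (s≤s n≤m) = ∣m-n∣<∣1+m-n∣ n≤m

module _ {m n p q : ℕ} (p<q : p < q) where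

  Approach : Rel (Word m n) 0ℓ
  Approach x y = ∃₂ λ i a → 𝓑 p q m n (x [ i ]≔ a) × dist (x [ i ]≔ a) y < dist x y

  raise : ∀ x y → 𝓑 p q m n x → wt x < q →
          (∃ λ i → toℕ (lookup x i) < toℕ (lookup y i)) → Approach x y
  raise x y (p≤x , _) x<q (i , xᵢ<yᵢ) = i , a ,
    (≤-trans p≤x (≤-trans (n≤1+n (wt x)) (≤-reflexive (sym wt≡))) , ≤-trans (≤-reflexive wt≡) x<q) ,
    dist-≔ x y i a (subst (λ k → ∣ k - toℕ (lookup y i) ∣ < ∣ u - toℕ (lookup y i) ∣) (sym a≡) (∣1+m-n∣<∣m-n∣ xᵢ<yᵢ))
    where
    open ≡-Reasoning
    u = toℕ (lookup x i)
    -- The letter of `y` lies strictly above that of `x`, so the next letter after `u` is still in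
    -- the alphabet.
    1+u<m = ≤-<-trans xᵢ<yᵢ (toℕ<n (lookup y i))
    a = fromℕ< 1+u<m
    a≡ = toℕ-fromℕ< 1+u<m
    wt≡ : wt (x [ i ]≔ a) ≡ suc (wt x)
    wt≡ = +-cancelʳ-≡ u _ _ (begin
      wt (x [ i ]≔ a) + u ≡⟨ wt-≔ x i a ⟩
      wt x + toℕ a        ≡⟨ cong (wt x +_) a≡ ⟩
      wt x + suc u        ≡⟨ +-suc (wt x) u ⟩
      suc (wt x) + u      ∎)

  lower : ∀ x y → 𝓑 p q m n x → p < wt x →
          (∃ λ i → toℕ (lookup y i) < toℕ (lookup x i)) → Approach x y
  lower x y (_ , x≤q) p<x (i , yᵢ<xᵢ) = i , a ,
    (s≤s⁻¹ (≤-trans p<x (≤-reflexive (sym wt≡))) , ≤-trans (n≤1+n _) (≤-trans (≤-reflexive wt≡) x≤q)) ,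
    dist-≔ x y i a (subst (λ k → ∣ toℕ a - toℕ (lookup y i) ∣ < ∣ k - toℕ (lookup y i) ∣) (sym u≡)
      (∣m-n∣<∣1+m-n∣ (s≤s⁻¹ (≤-trans yᵢ<xᵢ (≤-reflexive u≡)))))
    where
    open ≡-Reasoning
    u = toℕ (lookup x i)
    -- The letter to be lowered exceeds that of `y`, so it is positive, as `suc-pred` demands.
    instance _ = >-nonZero (≤-<-trans z≤n yᵢ<xᵢ)
    u-1<m = ≤-<-trans (pred[n]≤n {u}) (toℕ<n (lookup x i))
    a = fromℕ< u-1<m
    u≡ : u ≡ suc (toℕ a)
    u≡ = trans (sym (suc-pred u)) (cong suc (sym (toℕ-fromℕ< u-1<m)))
    wt≡ : suc (wt (x [ i ]≔ a)) ≡ wt x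
    wt≡ = +-cancelʳ-≡ (toℕ a) _ _ (begin
      suc (wt (x [ i ]≔ a)) + toℕ a ≡⟨ +-suc (wt (x [ i ]≔ a)) (toℕ a) ⟨
      wt (x [ i ]≔ a) + suc (toℕ a) ≡⟨ cong (wt (x [ i ]≔ a) +_) u≡ ⟨
      wt (x [ i ]≔ a) + u           ≡⟨ wt-≔ x i a ⟩
      wt x + toℕ a                  ∎)

  -- A letter below its target can be raised unless the weight is `q`, and one above can be lowered
  -- unless the weight is `p`. By `p < q` at most one kind of move is barred. If the other kind
  -- finds no letter, the words are comparable pointwise and the weights force equality.
  approach : ∀ x y → 𝓑 p q m n x → 𝓑 p q m n y → x ≡ y ⊎ Approach x y
  approach x y Bx By
    with any? (λ i → toℕ (lookup x i) <? toℕ (lookup y i))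
       | any? (λ i → toℕ (lookup y i) <? toℕ (lookup x i))
  ... | no ¬up | no ¬down =
    inj₁ (≤ʷ-wt-≡ x y (λ i → ≮⇒≥ (¬down ∘ (i ,_))) (wt-mono y x (λ i → ≮⇒≥ (¬up ∘ (i ,_)))))
  ... | no ¬up | yes down with p <? wt x
  ...   | yes p<x = inj₂ (lower x y Bx p<x down)
  ...   | no  p≮x = inj₁ (sym (≤ʷ-wt-≡ y x (λ i → ≮⇒≥ (¬up ∘ (i ,_))) (≤-trans (≮⇒≥ p≮x) (proj₁ By))))
  approach x y Bx By | yes up | down? with wt x <? q | down?
  ...   | yes x<q | _        = inj₂ (raise x y Bx x<q up)
  ...   | no  x≮q | yes down = inj₂ (lower x y Bx (<-≤-trans p<q (≮⇒≥ x≮q)) down)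
  ...   | no  x≮q | no ¬down =
    inj₁ (≤ʷ-wt-≡ x y (λ i → ≮⇒≥ (¬down ∘ (i ,_))) (≤-trans (proj₂ By) (≮⇒≥ x≮q)))

-- Enumeration of the words and construction of the overlap cycle.

allWords : ∀ m n → List (Word m n)
allWords m zero    = [ [] ]
allWords m (suc n) = cartesianProductWith _∷_ (allFin m) (allWords m n)

∈-allWords : ∀ {m n} (x : Word m n) → x ∈ allWords m n
∈-allWords []      = here refl
∈-allWords (a ∷ x) = ∈-cartesianProductWith⁺ _∷_ (∈-allFin a) (∈-allWords x)

theorem3p5 : (m n s p q : ℕ) → 1 ≤ s → s < n → p < q → q ≤ (m ∸ 1) * n →
    HasOCycle s (𝓑 p q m n)
-- `s < n` rules out length zero, and the length `suc N` is a period of `σ`.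
theorem3p5 m n@(suc N) s p q _ s<n p<q _ =
  let xs , C , complete = hamiltonian connected (all-filter S? (allWords m n))
                            (∈-filter⁺ S? (∈-allWords _))
  in xs , record
    { unique   = Cycle.unique C
    ; elements = λ x → mk⇔ (Cycle.inside C) complete
    ; overlaps = Cycle.linked C
    }
  where
  t : ℕ
  t = n ∸ s

  S : Pred (Word m n) 0ℓ
  S = 𝓑 p q m n

  S? : Decidable S
  S? x = (p ≤? wt x) ×-dec (wt x ≤? q)

  σ : Word m n → Word m n
  σ x = fold x rotate t

  σ-S : ∀ {x} → S x → S (σ x)
  σ-S {x} = subst (λ w → p ≤ w × w ≤ q) (sym (wt-rotates x t))

  -- Positions from `t` on carry the last `s` letters, the only ones that `Overlap s` reads in its
  -- first argument.
  SameSuffix : Rel (Word m n) 0ℓ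
  SameSuffix x y = ∀ i → t ≤ toℕ i → lookup x i ≡ lookup y i

  open CycleJoining (≡-dec _≟ᶠ_) S (Overlap s) SameSuffix
    (λ x≈y i t≤i → sym (x≈y i t≤i))
    (λ x≈y xRz i j j<s i≡ → trans (sym (x≈y i (subst (t ≤_) (sym i≡) (m≤m+n t (toℕ j))))) (xRz i j j<s i≡))
    σ N (λ x → rotates-period x t)
    (λ x i j _ i≡ → lookup-rotates x t i j i≡)
    σ-S

  -- Rotating brings any position i in front of the last s letters, where a
  -- letter can be changed by a switch.
  change : ∀ b {x} i {a} → toℕ i < b → S (x [ i ]≔ a) → Star Step x (x [ i ]≔ a)
  change (suc b) {x} i {a} (s≤s i≤b) S′ with toℕ i <? t
  -- Position `i` lies before the suffix, which the change therefore leaves intact.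
  ... | yes i<t = switch S′ (λ j t≤j → sym (lookup∘update′ (λ { refl → <⇒≱ i<t t≤j }) x a)) ◅ ε
  -- Rotate, change the letter at its new position `j`, which is `i` less `t`, and rotate back.
  ... | no  i≮t = forward ◅ (subst (Star Step (σ x)) (sym σ≡) (change b j j<b (subst S σ≡ (σ-S S′)))
                             ◅◅ (backward refl ◅ ε))
    where
    t≤i = ≮⇒≥ i≮t
    i∸t<n = ≤-<-trans (m∸n≤m (toℕ i) t) (toℕ<n i)
    j : Fin n
    j = fromℕ< i∸t<n
    i≡ : toℕ i ≡ t + toℕ j
    i≡ = trans (sym (m+[n∸m]≡n t≤i)) (cong (t +_) (sym (toℕ-fromℕ< i∸t<n)))
    σ≡ = rotates-≔ x t i j i≡
    -- `t` is positive because `s < n`, so `j` is strictly smaller than `i` and the bound can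
    -- decrease.
    j<b : toℕ j < b
    j<b = <-≤-trans (subst (toℕ j <_) (sym i≡) (m<n+m (toℕ j) (m<n⇒0<n∸m s<n))) i≤b

  -- Each change supplied by `approach` shrinks the distance to `y`, so the recursion is well
  -- founded.
  connected : ∀ {x y} → S x → S y → Star Step x y
  connected {x} {y} Sx Sy = go x Sx (<-wellFounded (dist x y))
    where
    go : ∀ x → S x → Acc _<_ (dist x y) → Star Step x y
    go x Sx (acc rs) with approach p<q x y Sx Sy
    ... | inj₁ refl = ε
    ... | inj₂ (i , a , S′ , closer) =
      change (suc (toℕ i)) i ≤-refl S′ ◅◅ go (x [ i ]≔ a) S′ (rs closer)
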